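{- Let $m\ge 2$ and let $h_\omega$ be the infinite $m$-bonacci word. The sequence of lengths of the maximal blocks of consecutive $1$'s in the oc-sequence $oc(h_\omega)$ is exactly $|h_i|$, for all $i\ge 0$.
   Context: Fix $m\ge 2$ and $A_m=\{0,1,\ldots,m-1\}$. The morphism $\varphi_m:A_m^*\to A_m^*$ is given by $\varphi_m(i)=0(i+1)$ (the two-letter word with letters $0$ and $i+1$) for $0\le i\le m-2$ and $\varphi_m(m-1)=0$. Put $h_n=\varphi_m^n(0)$ for $n\ge 0$; the infinite $m$-bonacci word $h_\omega$ is the fixed point of $\varphi_m$ starting with $0$. $|w|$ is the length of a word $w$. A word $x$ is a border of $w$ if it is nonempty and both a prefix and a suffix of $w$. A nonempty finite word $w$ is closed if it is a single letter or it has a border $x$ that occurs exactly twice in $w$ (as a prefix and as a suffix, with no other occurrence); otherwise it is open. The oc-sequence $oc(\boldsymbol{w})$ of an infinite word $\boldsymbol{w}$ is the binary sequence $x_1x_2x_3\cdots$ with $x_n=1$ if the prefix of length $n$ of $\boldsymbol{w}$ is closed and $x_n=0$ if it is open.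
   Formalization: The oc-sequence begins 1,0,1,0, so its first two blocks of 1's both have length 1, whereas |h_1| = 2; the statement proved is that the sequence of block lengths is 1, |h_0|, |h_1|, |h_2|, …, with one extra initial block coming from the one-letter prefix. -}

module Defs where

open import Data.Bool.Base using (Bool; true; false)
open import Data.Empty using (⊥-elim)
open import Data.Fin.Base using (Fin; zero; suc; toℕ; fromℕ<)
import Data.Fin.Properties as Fin
open import Data.List.Base
  using (List; []; _∷_; [_]; _++_; length; take; drop; concatMap; applyUpTo)
open import Data.List.Properties
  using (concatMap-++; length-++; length-drop; ++-assoc; ++-identityʳ)
open import Data.List.Relation.Binary.Prefix.Heterogeneous using (Prefix; []; _∷_)
open import Data.List.Relation.Binary.Prefix.Heterogeneous.Properties using (prefix?; length-mono)
open import Data.List.Relation.Binary.Suffix.Heterogeneous using (Suffix)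
open import Data.List.Relation.Binary.Suffix.Heterogeneous.Properties using (suffix?)
open import Data.Nat.Base
open import Data.Nat.Properties
open import Data.Product.Base using (∃-syntax; _×_; _,_; proj₁; proj₂)
open import Data.Sum.Base using (_⊎_; inj₁; inj₂)
open import Relation.Binary.Definitions using (DecidableEquality)
open import Relation.Binary.PropositionalEquality
  using (_≡_; _≢_; refl; sym; trans; cong; cong₂; subst)
open import Relation.Nullary.Decidable using (Dec; yes; no; does; map′; _×-dec_; _⊎-dec_; _→-dec_)

private
  variable
    A : Set
    m : ℕ

Border : List A → List A → Set
Border x w = x ≢ [] × Prefix _≡_ x w × Suffix _≡_ x w

-- Positions count from 0.  Only used for nonempty x, for which
-- p + length x ≤ length w is automatic.
OccursAt : List A → List A → ℕ → Set
OccursAt x w p = Prefix _≡_ x (drop p w)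

-- For a border x of w: the prefix and the suffix occurrence are distinct
-- (length x < length w), and there is no other occurrence.
OccursOnlyAtBothEnds : List A → List A → Set
OccursOnlyAtBothEnds x w =
  length x < length w ×
  (∀ p → OccursAt x w p → p ≡ 0 ⊎ p + length x ≡ length w)

Closed : List A → Set
Closed w = length w ≡ 1 ⊎ (∃[ x ] (Border x w × OccursOnlyAtBothEnds x w))

module _ (_≟ᴬ_ : DecidableEquality A) where

  private
    nonempty? : (x : List A) → Dec (x ≢ [])
    nonempty? []      = no (λ ne → ne refl)
    nonempty? (_ ∷ _) = yes (λ ())

    prefix≡take : {x w : List A} → Prefix _≡_ x w → x ≡ take (length x) w
    prefix≡take []         = refl
    prefix≡take (refl ∷ p) = cong (_ ∷_) (prefix≡take p)

    occursAt<length : {x w : List A} → x ≢ [] → ∀ p → OccursAt x w p → p < length w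
    occursAt<length {[]}    ne p o = ⊥-elim (ne refl)
    occursAt<length {_ ∷ x} {w} ne p o =
      m<n∸m⇒ (subst (0 <_) (length-drop p w) (≤-trans (s≤s z≤n) (length-mono o)))
      where
      m<n∸m⇒ : 0 < length w ∸ p → p < length w
      m<n∸m⇒ q = ≰⇒> λ le → <-irrefl (sym (m≤n⇒m∸n≡0 le)) q

    closingBorder? : (x w : List A) → Dec (Border x w × OccursOnlyAtBothEnds x w)
    closingBorder? x w with nonempty? x
    ... | no ¬ne = no (λ b → ¬ne (proj₁ (proj₁ b)))
    ... | yes ne =
      (yes ne ×-dec prefix? _≟ᴬ_ x w ×-dec suffix? _≟ᴬ_ x w) ×-dec
      (length x <? length w) ×-dec
      map′ (λ f p o → f (occursAt<length ne p o) o) (λ f {p} _ → f p)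
        (allUpTo? (λ p → prefix? _≟ᴬ_ x (drop p w)
                         →-dec (p ≟ 0 ⊎-dec p + length x ≟ length w))
                  (length w))

  closed? : (w : List A) → Dec (Closed w)
  closed? w =
    length w ≟ 1 ⊎-dec
    map′ (λ (k , _ , c) → take k w , c)
         (λ (x , c@((_ , pre , _) , lt , _)) →
            length x , lt ,
            subst (λ y → Border y w × OccursOnlyAtBothEnds y w) (prefix≡take pre) c)
         (anyUpTo? (λ k → closingBorder? (take k w) w) (length w))

-- The prefix of length n of an infinite word.
prefixOf : (ℕ → A) → ℕ → List A
prefixOf = applyUpTo

-- The term of index n is x_{n+1}: it concerns the prefix of length n + 1.
oc : (ℕ → Fin m) → ℕ → Bool
oc w n = does (closed? Fin._≟_ (prefixOf w (suc n)))

-- f(w) = w, expressed on finite prefixes: the image under f of each prefix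
-- of w is again a prefix of w.  This determines f(w) when f is non-erasing.
IsFixedPoint : (A → List A) → (ℕ → A) → Set
IsFixedPoint f w =
  ∀ n → let u = concatMap f (prefixOf w n) in u ≡ prefixOf w (length u)

letter₀ : .{{_ : NonTrivial m}} → Fin m
letter₀ {2+ _} = zero

φ : .{{_ : NonTrivial m}} → Fin m → List (Fin m)
φ {m} i with suc (toℕ i) <? m
... | yes 1+i<m = letter₀ ∷ fromℕ< 1+i<m ∷ []
... | no  _     = letter₀ ∷ []

h : (m : ℕ) .{{_ : NonTrivial m}} → ℕ → List (Fin m)
h m zero    = [ letter₀ ]
h m (suc n) = concatMap φ (h m n)

IsMBonacciWord : (m : ℕ) .{{_ : NonTrivial m}} → (ℕ → Fin m) → Set
IsMBonacciWord m w = IsFixedPoint φ w × w 0 ≡ letter₀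

-- The 1's of s at the indices a, …, a + ℓ - 1 form a maximal block.
record IsMaximalBlock (s : ℕ → Bool) (a ℓ : ℕ) : Set where
  field
    nonempty : 0 < ℓ
    ones     : ∀ k → k < ℓ → s (a + k) ≡ true
    endsʳ    : s (a + ℓ) ≡ false
    endsˡ    : ∀ p → suc p ≡ a → s p ≡ false

-- The maximal blocks of 1's in s, listed from left to right, have lengths
-- L 0, L 1, L 2, ….
record IsBlockLengthSequence (s : ℕ → Bool) (L : ℕ → ℕ) : Set where
  field
    start    : ℕ → ℕ
    ordered  : ∀ i → start i < start (suc i)
    maximal  : ∀ i → IsMaximalBlock s (start i) (L i)
    complete : ∀ a ℓ → IsMaximalBlock s a ℓ → ∃[ i ] (a ≡ start i × ℓ ≡ L i)

-- The oc-sequence of the m-bonacci word starts 1 0 1 0: the word 0 is closed,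
-- 01 is open, 010 is closed, and 0100 (m = 2) or 0102 (m > 2) is open.  So
-- there are two blocks of length 1 = |h₀|: the one-letter prefix forms a block
-- of its own, and the later blocks have lengths |h₀|, |h₁|, |h₂|, ….
blockLengths : (m : ℕ) .{{_ : NonTrivial m}} → ℕ → ℕ
blockLengths m zero    = 1
blockLengths m (suc i) = length (h m i)

private
  at : .{{_ : NonTrivial m}} → List (Fin m) → ℕ → Fin m
  at []       _       = letter₀
  at (x ∷ xs) zero    = x
  at (x ∷ xs) (suc i) = at xs i

  at-++ : .{{_ : NonTrivial m}} (xs ys : List (Fin m)) → ∀ i → i < length xs →
          at (xs ++ ys) i ≡ at xs i
  at-++ (x ∷ xs) ys zero    _         = refl
  at-++ (x ∷ xs) ys (suc i) (s≤s i<n) = at-++ xs ys i i<n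

  split : .{{_ : NonTrivial m}} (w : ℕ → Fin m) (xs : List (Fin m)) → ∀ k → k ≤ length xs →
          (∀ i → i < length xs → w i ≡ at xs i) →
          xs ≡ applyUpTo w k ++ drop k xs
  split w xs       zero    _         eq = refl
  split w (x ∷ xs) (suc k) (s≤s k≤n) eq =
    cong₂ _∷_ (sym (eq 0 (s≤s z≤n)))
              (split (λ i → w (suc i)) xs k k≤n (λ i i<n → eq (suc i) (s≤s i<n)))

  readOff : .{{_ : NonTrivial m}} (w : ℕ → Fin m) (xs ys : List (Fin m)) →
            (∀ i → i < length (xs ++ ys) → w i ≡ at (xs ++ ys) i) →
            xs ≡ applyUpTo w (length xs)
  readOff w []       ys eq = refl
  readOff w (x ∷ xs) ys eq =
    cong₂ _∷_ (sym (eq 0 (s≤s z≤n)))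
              (readOff (λ i → w (suc i)) xs ys (λ i i<n → eq (suc i) (s≤s i<n)))

  at-applyUpTo : .{{_ : NonTrivial m}} (w : ℕ → Fin m) → ∀ n i → i < n →
                 at (applyUpTo w n) i ≡ w i
  at-applyUpTo w (suc n) zero    _         = refl
  at-applyUpTo w (suc n) (suc i) (s≤s i<n) = at-applyUpTo (λ j → w (suc j)) n i i<n

  φ≢[] : .{{_ : NonTrivial m}} (i : Fin m) → 0 < length (φ i)
  φ≢[] {m} i with suc (toℕ i) <? m
  ... | yes _ = s≤s z≤n
  ... | no  _ = s≤s z≤n

  φ*≢[] : .{{_ : NonTrivial m}} (xs : List (Fin m)) → 0 < length xs →
          0 < length (concatMap φ xs)
  φ*≢[] (x ∷ xs) _ = ≤-trans (φ≢[] x)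
    (≤-trans (m≤m+n _ _) (≤-reflexive (sym (length-++ (φ x)))))

module _ (m : ℕ) .{{_ : NonTrivial m}} where

  private
    h-grows : ∀ n → ∃[ t ] (0 < length t × h m (suc n) ≡ h m n ++ t)
    h-grows zero = base m
      where
      base : ∀ m .{{_ : NonTrivial m}} →
             ∃[ t ] (0 < length t × h m 1 ≡ h m 0 ++ t)
      base (2+ k) = [ suc zero ] , s≤s z≤n , refl
    h-grows (suc n) with h-grows n
    ... | t , 0<t , eq =
      concatMap φ t , φ*≢[] t 0<t ,
      trans (cong (concatMap φ) eq) (concatMap-++ φ (h m n) t)

    h-long : ∀ n → n < length (h m n)
    h-long zero    = s≤s z≤n
    h-long (suc n) with h-grows n
    ... | t , 0<t , eq rewrite eq | length-++ (h m n) {t} =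
      ≤-trans (≤-reflexive (+-comm 1 (suc n))) (+-mono-≤ (h-long n) 0<t)

    h-extends : ∀ n k → ∃[ t ] (h m (k + n) ≡ h m n ++ t)
    h-extends n zero    = [] , sym (++-identityʳ _)
    h-extends n (suc k) with h-extends n k | h-grows (k + n)
    ... | t , eq | s , _ , eq′ =
      t ++ s , trans eq′ (trans (cong (_++ s) eq) (++-assoc (h m n) t s))

    at-h : ∀ {n k} i → n ≤ k → i < length (h m n) → at (h m k) i ≡ at (h m n) i
    at-h {n} {k} i n≤k i<n with h-extends n (k ∸ n)
    ... | t , eq =
      trans (cong (λ xs → at xs i) (trans (cong (h m) (sym (m∸n+n≡m n≤k))) eq))
            (at-++ (h m n) t i i<n)

  hω : ℕ → Fin m
  hω i = at (h m i) i

  private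
    hω-h : ∀ n i → i < length (h m n) → hω i ≡ at (h m n) i
    hω-h n i i<n with ≤-total n i
    ... | inj₁ n≤i = at-h i n≤i i<n
    ... | inj₂ i≤n = sym (at-h i i≤n (h-long i))

  hω-isMBonacciWord : IsMBonacciWord m hω
  hω-isMBonacciWord = fixed , refl
    where
    fixed : IsFixedPoint φ hω
    fixed n = readOff hω _ (concatMap φ (drop n (h m n)))
                (subst (λ xs → ∀ i → i < length xs → hω i ≡ at xs i) eq (hω-h (suc n)))
      where
      eq : h m (suc n) ≡ concatMap φ (applyUpTo hω n) ++ concatMap φ (drop n (h m n))
      eq = trans (cong (concatMap φ) (split hω (h m n) n (<⇒≤ (h-long n)) (hω-h n)))
                 (concatMap-++ φ (applyUpTo hω n) _)

  mBonacciWord-unique : ∀ w → IsMBonacciWord m w → ∀ i → w i ≡ hω i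
  mBonacciWord-unique w (fixed , w0) i =
    trans (sym (at-applyUpTo w _ i (h-long i))) (cong (λ xs → at xs i) (sym (h-prefix i)))
    where
    h-prefix : ∀ n → h m n ≡ applyUpTo w (length (h m n))
    h-prefix zero    = cong [_] (sym w0)
    h-prefix (suc n) =
      trans (cong (concatMap φ) (h-prefix n))
        (trans (fixed (length (h m n)))
               (cong (λ xs → applyUpTo w (length (concatMap φ xs))) (sym (h-prefix n))))

{-# OPTIONS --safe #-}

-- For k > 0, a prefix is closed with closing border of length k exactly when
-- its length is k plus the first return time of the prefix of length k.  Let
-- H i = |h i|, L 0 = 0 and L (i + 1) = 1 + |φ(prefix of length L i)|.  Applying
-- φ to occurrences, and undoing it (φ i starts with 0, and the letter after
-- this 0 determines i), shows that the prefix of length k first returns at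
-- H (i + 1) when L i < k ≤ L (i + 1).  Since L (i + 1) = H i + L i, the lengths
-- of these closed prefixes form an interval of H i consecutive integers, and
-- consecutive intervals are separated because H is strictly increasing.
module Submission where

open import Defs
open import Data.Bool.Base using (Bool; true; false)
open import Data.Bool.Properties using (¬-not)
open import Data.Fin.Base using (Fin; toℕ; fromℕ<)
open import Data.Fin.Properties using (_≟_; toℕ-fromℕ<; toℕ-injective; toℕ<n)
open import Data.List.Base using (List; []; _∷_; [_]; _++_; _∷ʳ_; length; drop; concatMap)
open import Data.List.Properties
  using (length-applyUpTo; applyUpTo-∷ʳ; concatMap-++; length-++; ++-identityʳ; ++-cancelˡ;
         ∷-injectiveˡ; ∷-injectiveʳ)
open import Data.List.Relation.Binary.Pointwise using (Pointwise-≡⇒≡; ≡⇒Pointwise-≡)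
open import Data.List.Relation.Binary.Prefix.Heterogeneous using (Prefix; []; _∷_)
open import Data.List.Relation.Binary.Suffix.Heterogeneous using (Suffix; here; there)
open import Data.Nat.Base
  using (ℕ; NonTrivial; zero; suc; _+_; _∸_; _≤_; _<_; _≮_; z≤n; s≤s; z<s; s≤s⁻¹;
         2+; nonTrivial⇒n>1)
open import Data.Nat.Properties hiding (_≟_)
open import Data.Product.Base using (∃-syntax; _×_; _,_; proj₁; proj₂)
open import Data.Sum.Base using (_⊎_; inj₁; inj₂)
open import Relation.Binary.Definitions using (tri<; tri≈; tri>)
open import Relation.Binary.PropositionalEquality
  using (_≡_; _≢_; refl; sym; trans; cong; cong₂; subst; module ≡-Reasoning)
open import Relation.Nullary.Decidable using (Dec; yes; no; does; dec-true)
open import Relation.Nullary.Negation using (¬_; contradiction)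

private
  variable
    A : Set

-- Occurrences in prefixes of infinite words

prefixOf-cong : ∀ (f g : ℕ → A) k → (∀ j → j < k → f j ≡ g j) → prefixOf f k ≡ prefixOf g k
prefixOf-cong f g zero    eq = refl
prefixOf-cong f g (suc k) eq =
  cong₂ _∷_ (eq 0 z<s) (prefixOf-cong _ _ k λ j j<k → eq (suc j) (s≤s j<k))

prefixOf-++ : ∀ (f : ℕ → A) a b →
              prefixOf f (a + b) ≡ prefixOf f a ++ prefixOf (λ j → f (a + j)) b
prefixOf-++ f zero    b = refl
prefixOf-++ f (suc a) b = cong (f 0 ∷_) (prefixOf-++ _ a b)

drop-prefixOf : ∀ (f : ℕ → A) p n → drop p (prefixOf f n) ≡ prefixOf (λ j → f (p + j)) (n ∸ p)
drop-prefixOf f zero    n       = refl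
drop-prefixOf f (suc p) zero    = refl
drop-prefixOf f (suc p) (suc n) = drop-prefixOf _ p n

Prefix-prefixOf⁺ : ∀ (f g : ℕ → A) {k n} → k ≤ n → (∀ j → j < k → g j ≡ f j) →
                   Prefix _≡_ (prefixOf f k) (prefixOf g n)
Prefix-prefixOf⁺ f g z≤n       eq = []
Prefix-prefixOf⁺ f g (s≤s k≤n) eq =
  sym (eq 0 z<s) ∷ Prefix-prefixOf⁺ _ _ k≤n λ j j<k → eq (suc j) (s≤s j<k)

Prefix-prefixOf⁻ : ∀ (f g : ℕ → A) k n → Prefix _≡_ (prefixOf f k) (prefixOf g n) →
                   k ≤ n × (∀ j → j < k → g j ≡ f j)
Prefix-prefixOf⁻ f g zero    n       _        = z≤n , λ _ ()
Prefix-prefixOf⁻ f g (suc k) (suc n) (eq ∷ pre) with Prefix-prefixOf⁻ _ _ k n pre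
... | k≤n , eqs = s≤s k≤n , λ where
  zero    _         → sym eq
  (suc j) (s≤s j<k) → eqs j j<k

Prefix⇒≡prefixOf : ∀ (f : ℕ → A) {x} n → Prefix _≡_ x (prefixOf f n) → x ≡ prefixOf f (length x)
Prefix⇒≡prefixOf f zero    []         = refl
Prefix⇒≡prefixOf f (suc n) []         = refl
Prefix⇒≡prefixOf f (suc n) (refl ∷ p) = cong (f 0 ∷_) (Prefix⇒≡prefixOf _ n p)

Prefix-reflexive : {x y : List A} → x ≡ y → Prefix _≡_ x y
Prefix-reflexive {x = []}    refl = []
Prefix-reflexive {x = _ ∷ _} refl = refl ∷ Prefix-reflexive refl

Suffix⇒drop : {x u : List A} → Suffix _≡_ x u → ∃[ p ] (p + length x ≡ length u × x ≡ drop p u)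
Suffix⇒drop (here eqs) = 0 , cong length (Pointwise-≡⇒≡ eqs) , Pointwise-≡⇒≡ eqs
Suffix⇒drop (there s) with Suffix⇒drop s
... | p , len , eq = suc p , cong suc len , eq

Suffix-prefixOf : ∀ (f g : ℕ → A) p k → (∀ j → j < k → g (p + j) ≡ f j) →
                  Suffix _≡_ (prefixOf f k) (prefixOf g (p + k))
Suffix-prefixOf f g zero    k eq =
  here (≡⇒Pointwise-≡ (prefixOf-cong f g k λ j j<k → sym (eq j j<k)))
Suffix-prefixOf f g (suc p) k eq = there (Suffix-prefixOf f _ p k eq)

-- First return times and closed prefixes.

module _ (w : ℕ → A) where

  -- An occurrence in the infinite word itself, so that no ambient prefix length has to be carried
  -- along.
  Agree : ℕ → ℕ → Set
  Agree p k = ∀ j → j < k → w (p + j) ≡ w j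

  Agree-≤ : ∀ {p k n} → k ≤ n → Agree p n → Agree p k
  Agree-≤ k≤n agree j j<k = agree j (<-≤-trans j<k k≤n)

  occursAt⁺ : ∀ {p k n} → p + k ≤ n → Agree p k → OccursAt (prefixOf w k) (prefixOf w n) p
  occursAt⁺ {p} {k} {n} p+k≤n agree =
    subst (Prefix _≡_ _) (sym (drop-prefixOf w p n))
      (Prefix-prefixOf⁺ w _ (m+n≤o⇒m≤o∸n k (subst (_≤ n) (+-comm p k) p+k≤n)) agree)

  occursAt⁻ : ∀ {p k n} → 0 < k → OccursAt (prefixOf w k) (prefixOf w n) p →
              p + k ≤ n × Agree p k
  occursAt⁻ {p} {k} {n} 0<k occ
    with Prefix-prefixOf⁻ w _ k (n ∸ p) (subst (Prefix _≡_ _) (drop-prefixOf w p n) occ)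
  ... | k≤n∸p , agree =
    subst (_≤ n) (+-comm k p) (m≤o∸n⇒m+n≤o k (<⇒≤ p<n) k≤n∸p) , agree
    where
    -- `n ∸ p` is truncated, so only its being positive excludes positions past the end.
    p<n : p < n
    p<n = m∸n≢0⇒n<m (m<n⇒n≢0 (<-≤-trans 0<k k≤n∸p))

  record FirstReturn (k p : ℕ) : Set where
    field
      positive : 0 < p
      returns  : Agree p k
      minimal  : ∀ q → 0 < q → Agree q k → p ≤ q

  open FirstReturn

  -- The closing border is the prefix of length `k`: an occurrence at a positive `q` fits only if
  -- `q ≤ p`, and minimality gives `p ≤ q`.
  firstReturn⇒closed : ∀ {k p} → 0 < k → FirstReturn k p → Closed (prefixOf w (p + k))
  firstReturn⇒closed {k} {p} 0<k ret =
    inj₂ (prefixOf w k , (nonempty 0<k , pre , Suffix-prefixOf w w p k (returns ret)) , short , only)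
    where
    nonempty : ∀ {k} → 0 < k → prefixOf w k ≢ []
    nonempty z<s ()

    pre : Prefix _≡_ (prefixOf w k) (prefixOf w (p + k))
    pre = occursAt⁺ {0} (m≤n+m k p) (λ _ _ → refl)

    short : length (prefixOf w k) < length (prefixOf w (p + k))
    short rewrite length-applyUpTo w k | length-applyUpTo w (p + k) =
      +-monoˡ-≤ k (positive ret)

    only : ∀ q → OccursAt (prefixOf w k) (prefixOf w (p + k)) q →
           q ≡ 0 ⊎ q + length (prefixOf w k) ≡ length (prefixOf w (p + k))
    only zero      _   = inj₁ refl
    only q@(suc _) occ rewrite length-applyUpTo w k | length-applyUpTo w (p + k)
      with occursAt⁻ {q} 0<k occ
    ... | q+k≤p+k , agree =
      inj₂ (≤-antisym q+k≤p+k (+-monoˡ-≤ k (minimal ret q z<s agree)))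

  -- A closing border is a prefix of `w`, and a return before its suffix occurrence would fit inside
  -- as a third occurrence. Length 1 stays apart, as a single letter has no border shorter than
  -- itself.
  closed⇒firstReturn : ∀ n → Closed (prefixOf w n) →
                       n ≡ 1 ⊎ ∃[ k ] ∃[ p ] (0 < k × p + k ≡ n × FirstReturn k p)
  closed⇒firstReturn n (inj₁ eq) = inj₁ (trans (sym (length-applyUpTo w n)) eq)
  closed⇒firstReturn n (inj₂ (x , (x≢[] , pre , suf) , short , only))
    with length x | Prefix⇒≡prefixOf w n pre | length-applyUpTo w n
  ... | k | refl | |w| with Suffix⇒drop suf
  ... | p , len , eq rewrite length-applyUpTo w k | |w| =
    inj₂ (k , p , 0<k , len , record
      { positive = +-cancelʳ-< k 0 p (subst (k <_) (sym len) short)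
      ; returns  = proj₂ (occursAt⁻ {p} 0<k (Prefix-reflexive eq))
      ; minimal  = λ q 0<q agree → ≮⇒≥ (q≮p q 0<q agree)
      })
    where
    0<k : 0 < k
    0<k = n≢0⇒n>0 λ { refl → x≢[] refl }

    q≮p : ∀ q → 0 < q → Agree q k → q ≮ p
    q≮p q 0<q agree q<p with subst (q + k <_) len (+-monoˡ-< k q<p)
    ... | q+k<n with only q (occursAt⁺ (<⇒≤ q+k<n) agree)
    ... | inj₁ refl = <-irrefl refl 0<q
    ... | inj₂ q+k≡n = <-irrefl q+k≡n q+k<n

-- The m-bonacci word under φ

toℕ-letter₀ : ∀ {m} .{{_ : NonTrivial m}} → toℕ (letter₀ {m}) ≡ 0
toℕ-letter₀ {2+ _} = refl

module _ {m : ℕ} .{{_ : NonTrivial m}} where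

  -- Addition of 1 modulo `m`. Inside `w` it gives the letter after the leading 0 of `φ i` in all
  -- cases: for `i = m - 1` that letter is the 0 opening the next image.
  cyclicSuc : Fin m → Fin m
  cyclicSuc i with suc (toℕ i) <? m
  ... | yes 1+i<m = fromℕ< 1+i<m
  ... | no  _     = letter₀

  fromℕ<-suc≢letter₀ : ∀ {i} (1+i<m : suc i < m) → fromℕ< 1+i<m ≢ letter₀
  fromℕ<-suc≢letter₀ 1+i<m eq =
    contradiction (trans (sym (toℕ-fromℕ< 1+i<m)) (trans (cong toℕ eq) toℕ-letter₀)) λ ()

  cyclicSuc-injective : ∀ i j → cyclicSuc i ≡ cyclicSuc j → i ≡ j
  cyclicSuc-injective i j eq with suc (toℕ i) <? m | suc (toℕ j) <? m
  ... | yes p | yes q = toℕ-injective (suc-injective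
          (trans (sym (toℕ-fromℕ< p)) (trans (cong toℕ eq) (toℕ-fromℕ< q))))
  ... | yes p | no  _ = contradiction eq (fromℕ<-suc≢letter₀ p)
  ... | no  _ | yes q = contradiction (sym eq) (fromℕ<-suc≢letter₀ q)
  ... | no ¬p | no ¬q = toℕ-injective (suc-injective
          (trans (≤-antisym (toℕ<n i) (≮⇒≥ ¬p)) (≤-antisym (≮⇒≥ ¬q) (toℕ<n j))))

  data Image (i : Fin m) : List (Fin m) → Set where
    two : cyclicSuc i ≢ letter₀ → Image i (letter₀ ∷ cyclicSuc i ∷ [])
    one : cyclicSuc i ≡ letter₀ → Image i [ letter₀ ]

  φ-image : ∀ i → Image i (φ i)
  -- The constructors are abstracted along with the test so that `cyclicSuc i` in their types
  -- reduces together with `φ i`.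
  φ-image i with suc (toℕ i) <? m | two {i} | one {i}
  ... | yes p | mk | _  = mk (fromℕ<-suc≢letter₀ p)
  ... | no  _ | _  | mk = mk refl

  length-φ-letter₀ : length (φ (letter₀ {m})) ≡ 2
  length-φ-letter₀ with suc (toℕ (letter₀ {m})) <? m
  ... | yes _   = refl
  ... | no 1≮m = contradiction
          (subst (λ i → suc i < m) (sym toℕ-letter₀) (nonTrivial⇒n>1 m)) 1≮m

module MBonacci (m : ℕ) .{{_ : NonTrivial m}} (w : ℕ → Fin m) (isW : IsMBonacciWord m w) where

  -- As `φ` fixes `w`, this is the position in `w` where the image of the letter `w q` begins.
  ℓ : ℕ → ℕ
  ℓ q = length (concatMap φ (prefixOf w q))

  image-suc : ∀ q → concatMap φ (prefixOf w (suc q)) ≡ concatMap φ (prefixOf w q) ++ φ (w q)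
  image-suc q = begin
    concatMap φ (prefixOf w (suc q))
      ≡⟨ cong (concatMap φ) (applyUpTo-∷ʳ w q) ⟨
    concatMap φ (prefixOf w q ∷ʳ w q)
      ≡⟨ concatMap-++ φ (prefixOf w q) _ ⟩
    concatMap φ (prefixOf w q) ++ (φ (w q) ++ [])
      ≡⟨ cong (concatMap φ (prefixOf w q) ++_) (++-identityʳ (φ (w q))) ⟩
    concatMap φ (prefixOf w q) ++ φ (w q)
      ∎
    where open ≡-Reasoning

  ℓ-suc : ∀ q → ℓ (suc q) ≡ ℓ q + length (φ (w q))
  ℓ-suc q = trans (cong length (image-suc q)) (length-++ (concatMap φ (prefixOf w q)))

  -- The fixed-point equations for the prefixes of lengths `q` and `q + 1` differ by exactly this
  -- factor; the common part cancels.
  φ-occurs : ∀ q → φ (w q) ≡ prefixOf (λ j → w (ℓ q + j)) (length (φ (w q)))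
  φ-occurs q = ++-cancelˡ (prefixOf w (ℓ q)) _ _ (begin
    prefixOf w (ℓ q) ++ φ (w q)           ≡⟨ cong (_++ φ (w q)) (proj₁ isW q) ⟨
    concatMap φ (prefixOf w q) ++ φ (w q) ≡⟨ image-suc q ⟨
    concatMap φ (prefixOf w (suc q))      ≡⟨ proj₁ isW (suc q) ⟩
    prefixOf w (ℓ (suc q))                ≡⟨ cong (prefixOf w) (ℓ-suc q) ⟩
    prefixOf w (ℓ q + length (φ (w q)))   ≡⟨ prefixOf-++ w (ℓ q) _ ⟩
    prefixOf w (ℓ q) ++ prefixOf (λ j → w (ℓ q + j)) (length (φ (w q))) ∎)
    where open ≡-Reasoning

  w-ℓ : ∀ q → w (ℓ q) ≡ letter₀
  w-ℓ q with φ (w q) | φ-image (w q) | φ-occurs q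
  ... | _ | two _ | eq = trans (cong w (sym (+-identityʳ (ℓ q)))) (sym (∷-injectiveˡ eq))
  ... | _ | one _ | eq = trans (cong w (sym (+-identityʳ (ℓ q)))) (sym (∷-injectiveˡ eq))

  -- Cutting `w` into images of letters.

  data Step (q : ℕ) : Set where
    two : ℓ (suc q) ≡ 2+ (ℓ q) → w (suc (ℓ q)) ≢ letter₀ → Step q
    one : ℓ (suc q) ≡ suc (ℓ q) → Step q

  step : ∀ q → Step q × w (suc (ℓ q)) ≡ cyclicSuc (w q)
  step q with φ (w q) | φ-image (w q) | φ-occurs q | ℓ-suc q
  ... | _ | two ≢0 | eq | len =
    two (trans len (+-comm (ℓ q) 2)) (λ ≡0 → ≢0 (trans (sym next) ≡0)) , next
    where
    next : w (suc (ℓ q)) ≡ cyclicSuc (w q)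
    next = trans (cong w (+-comm 1 (ℓ q))) (sym (∷-injectiveˡ (∷-injectiveʳ eq)))
  ... | _ | one ≡0 | eq | len =
    -- After a one-letter image the next position opens another image, hence carries 0.
    one 1+ℓ , trans (trans (cong w (sym 1+ℓ)) (w-ℓ (suc q))) (sym ≡0)
    where
    1+ℓ : ℓ (suc q) ≡ suc (ℓ q)
    1+ℓ = trans len (+-comm (ℓ q) 1)

  w-1+ℓ : ∀ q → w (suc (ℓ q)) ≡ cyclicSuc (w q)
  w-1+ℓ q = proj₂ (step q)

  ℓ<ℓ-suc : ∀ q → ℓ q < ℓ (suc q)
  ℓ<ℓ-suc q with proj₁ (step q)
  ... | two eq _ = ≤-trans (n≤1+n _) (≤-reflexive (sym eq))
  ... | one eq   = ≤-reflexive (sym eq)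

  ℓ-mono-≤ : ∀ {p q} → p ≤ q → ℓ p ≤ ℓ q
  ℓ-mono-≤ {q = zero}  z≤n = ≤-refl
  ℓ-mono-≤ {q = suc q} p≤1+q with m≤n⇒m<n∨m≡n p≤1+q
  ... | inj₁ p<1+q = ≤-trans (ℓ-mono-≤ (s≤s⁻¹ p<1+q)) (<⇒≤ (ℓ<ℓ-suc q))
  ... | inj₂ refl  = ≤-refl

  ℓ-mono-< : ∀ {p q} → p < q → ℓ p < ℓ q
  ℓ-mono-< {p} p<q = <-≤-trans (ℓ<ℓ-suc p) (ℓ-mono-≤ p<q)

  ℓ-cancel-< : ∀ {p q} → ℓ p < ℓ q → p < q
  ℓ-cancel-< ℓp<ℓq = ≰⇒> λ q≤p → <⇒≱ ℓp<ℓq (ℓ-mono-≤ q≤p)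

  data Position : ℕ → Set where
    first  : ∀ q → Position (ℓ q)
    second : ∀ q → ℓ (suc q) ≡ 2+ (ℓ q) → w (suc (ℓ q)) ≢ letter₀ → Position (suc (ℓ q))

  position : ∀ p → Position p
  position zero = first 0
  position (suc p) with position p
  ... | second q eq _ = subst Position eq (first (suc q))
  ... | first q with proj₁ (step q)
  ...   | two eq ≢0 = second q eq ≢0
  ...   | one eq    = subst Position eq (first (suc q))

  letter₀⇒ℓ : ∀ p → w p ≡ letter₀ → ∃[ q ] p ≡ ℓ q
  letter₀⇒ℓ p ≡0 with position p
  ... | first q       = q , refl
  ... | second q _ ≢0 = contradiction ≡0 ≢0

  -- Transfer of occurrences along `φ`.

  ℓ-+ : ∀ q n → Agree w q n → ℓ (q + n) ≡ ℓ q + ℓ n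
  ℓ-+ q zero    _     = trans (cong ℓ (+-identityʳ q)) (sym (+-identityʳ (ℓ q)))
  ℓ-+ q (suc n) agree = begin
    ℓ (q + suc n)                       ≡⟨ cong ℓ (+-suc q n) ⟩
    ℓ (suc (q + n))                     ≡⟨ ℓ-suc (q + n) ⟩
    ℓ (q + n) + length (φ (w (q + n)))  ≡⟨ cong₂ _+_ (ℓ-+ q n (Agree-≤ w (n≤1+n n) agree))
                                             (cong (λ i → length (φ i)) (agree n ≤-refl)) ⟩
    ℓ q + ℓ n + length (φ (w n))        ≡⟨ +-assoc (ℓ q) (ℓ n) _ ⟩
    ℓ q + (ℓ n + length (φ (w n)))      ≡⟨ cong (ℓ q +_) (ℓ-suc n) ⟨
    ℓ q + ℓ (suc n)                     ∎
    where open ≡-Reasoning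

  -- In each image the first letter is 0 and the second is determined by the preimage. The extra 1
  -- is the 0 that opens the next image at both places, whatever letters come next.
  substitute : ∀ q n → Agree w q n → Agree w (ℓ q) (suc (ℓ n))
  substitute q n agree j j≤ with position j
  ... | first r = begin
    w (ℓ q + ℓ r) ≡⟨ cong w (ℓ-+ q r (Agree-≤ w r≤n agree)) ⟨
    w (ℓ (q + r)) ≡⟨ w-ℓ (q + r) ⟩
    letter₀       ≡⟨ w-ℓ r ⟨
    w (ℓ r)       ∎
    where
    open ≡-Reasoning
    r≤n : r ≤ n
    r≤n = s≤s⁻¹ (ℓ-cancel-< (≤-<-trans (s≤s⁻¹ j≤) (ℓ<ℓ-suc n)))
  ... | second r _ _ = begin
    w (ℓ q + suc (ℓ r))     ≡⟨ cong w (+-suc (ℓ q) (ℓ r)) ⟩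
    w (suc (ℓ q + ℓ r))     ≡⟨ cong (λ p → w (suc p)) (ℓ-+ q r (Agree-≤ w (<⇒≤ r<n) agree)) ⟨
    w (suc (ℓ (q + r)))     ≡⟨ w-1+ℓ (q + r) ⟩
    cyclicSuc (w (q + r))   ≡⟨ cong cyclicSuc (agree r r<n) ⟩
    cyclicSuc (w r)         ≡⟨ w-1+ℓ r ⟨
    w (suc (ℓ r))           ∎
    where
    open ≡-Reasoning
    r<n : r < n
    r<n = ℓ-cancel-< (s≤s⁻¹ j≤)

  -- The last two compared letters are the 0 opening the image of `w n` and the letter after it,
  -- which determines `w n` by injectivity of `cyclicSuc`.
  desubstitute : ∀ q n → Agree w (ℓ q) (2+ (ℓ n)) → Agree w q (suc n)
  desubstitute q n agree j j≤n with m≤n⇒m<n∨m≡n (s≤s⁻¹ j≤n)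
  desubstitute q (suc n) agree j j≤n | inj₁ j<n =
    desubstitute q n (Agree-≤ w (s≤s (s≤s (<⇒≤ (ℓ<ℓ-suc n)))) agree) j j<n
  desubstitute q n agree .n _ | inj₂ refl = cyclicSuc-injective _ _ (begin
    cyclicSuc (w (q + n)) ≡⟨ w-1+ℓ (q + n) ⟨
    w (suc (ℓ (q + n)))   ≡⟨ cong (λ p → w (suc p)) (ℓ-+ q n (before n agree)) ⟩
    w (suc (ℓ q + ℓ n))   ≡⟨ cong w (+-suc (ℓ q) (ℓ n)) ⟨
    w (ℓ q + suc (ℓ n))   ≡⟨ agree (suc (ℓ n)) ≤-refl ⟩
    w (suc (ℓ n))         ≡⟨ w-1+ℓ n ⟩
    cyclicSuc (w n)       ∎)
    where
    open ≡-Reasoning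
    -- The agreement on earlier letters is what aligns `ℓ (q + n)` with `ℓ q + ℓ n`.
    before : ∀ n → Agree w (ℓ q) (2+ (ℓ n)) → Agree w q n
    before zero    _     _ ()
    before (suc n) agree =
      desubstitute q n (Agree-≤ w (s≤s (s≤s (<⇒≤ (ℓ<ℓ-suc n)))) agree)

  -- First return times of the prefixes of `w`.

  H : ℕ → ℕ
  H i = length (h m i)

  h-prefix : ∀ i → h m i ≡ prefixOf w (H i)
  h-prefix zero    = cong [_] (sym (proj₂ isW))
  h-prefix (suc i) = begin
    concatMap φ (h m i)
      ≡⟨ cong (concatMap φ) (h-prefix i) ⟩
    concatMap φ (prefixOf w (H i))
      ≡⟨ proj₁ isW (H i) ⟩
    prefixOf w (ℓ (H i))
      ≡⟨ cong (λ x → prefixOf w (length (concatMap φ x))) (h-prefix i) ⟨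
    prefixOf w (H (suc i))
      ∎
    where open ≡-Reasoning

  H-suc : ∀ i → H (suc i) ≡ ℓ (H i)
  H-suc i = cong (λ x → length (concatMap φ x)) (h-prefix i)

  H<H-suc : ∀ i → H i < H (suc i)
  H<H-suc zero = ≤-reflexive (sym (begin
    length (φ letter₀ ++ []) ≡⟨ cong length (++-identityʳ (φ letter₀)) ⟩
    length (φ (letter₀ {m})) ≡⟨ length-φ-letter₀ ⟩
    2                        ∎))
    where open ≡-Reasoning
  H<H-suc (suc i) = begin-strict
    H (suc i)     ≡⟨ H-suc i ⟩
    ℓ (H i)       <⟨ ℓ-mono-< (H<H-suc i) ⟩
    ℓ (H (suc i)) ≡⟨ H-suc (suc i) ⟨
    H (2+ i)      ∎
    where open ≤-Reasoning

  0<H : ∀ i → 0 < H i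
  0<H zero    = z<s
  0<H (suc i) = m<n⇒0<n (H<H-suc i)

  -- L i is the length of the longest common prefix of w and its shift by H i.
  L : ℕ → ℕ
  L zero    = 0
  L (suc i) = suc (ℓ (L i))

  -- The recursion of `L` is the gain in length made by `substitute`.
  agree-H : ∀ i → Agree w (H i) (L i)
  agree-H zero    _ ()
  agree-H (suc i) rewrite H-suc i = substitute (H i) (L i) (agree-H i)

  -- This makes the number of border lengths sharing one return time equal to `H i`. The agreement
  -- after a shift by `H i` lets `ℓ` split over the sum.
  L-suc : ∀ i → L (suc i) ≡ H i + L i
  L-suc zero    = refl
  L-suc (suc i) = begin
    suc (ℓ (L (suc i)))        ≡⟨ cong (λ n → suc (ℓ n)) (L-suc i) ⟩
    suc (ℓ (H i + L i))        ≡⟨ cong suc (ℓ-+ (H i) (L i) (agree-H i)) ⟩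
    suc (ℓ (H i) + ℓ (L i))    ≡⟨ +-suc (ℓ (H i)) (ℓ (L i)) ⟨
    ℓ (H i) + L (suc i)        ≡⟨ cong (_+ L (suc i)) (H-suc i) ⟨
    H (suc i) + L (suc i)      ∎
    where open ≡-Reasoning

  L<L-suc : ∀ i → L i < L (suc i)
  L<L-suc i = subst (L i <_) (sym (L-suc i)) (+-monoˡ-≤ (L i) (0<H i))

  -- The prefix starts with 0, so a return starts an image and `p` is `ℓ q` with `q` positive. At
  -- level 0 the least such value is `ℓ 1`, which is `H 1`; higher levels desubstitute to `q`.
  no-early-return : ∀ i p → 0 < p → Agree w p (suc (L i)) → H (suc i) ≤ p
  no-early-return i p 0<p agree
    with letter₀⇒ℓ p (trans (cong w (sym (+-identityʳ p))) (trans (agree 0 z<s) (proj₂ isW)))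
  no-early-return i       p 0<p agree | zero      , refl = contradiction 0<p λ ()
  no-early-return zero    p 0<p agree | suc q     , refl =
    subst (_≤ ℓ (suc q)) (sym (H-suc 0)) (ℓ-mono-≤ {1} {suc q} (s≤s z≤n))
  no-early-return (suc i) p 0<p agree | q@(suc _) , refl =
    subst (_≤ ℓ q) (sym (H-suc (suc i)))
      (ℓ-mono-≤ (no-early-return i q z<s (desubstitute q (L i) agree)))

  firstReturn-H : ∀ i k → L i < k → k ≤ L (suc i) → FirstReturn w k (H (suc i))
  firstReturn-H i k Li<k k≤L = record
    { positive = 0<H (suc i)
    ; returns  = Agree-≤ w k≤L (agree-H (suc i))
    ; minimal  = λ q 0<q agree → no-early-return i q 0<q (Agree-≤ w Li<k agree)
    }

  -- Since `L` increases strictly from 0, these half-open intervals tile the positive integers.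
  L-interval : ∀ k → 0 < k → ∃[ i ] (L i < k × k ≤ L (suc i))
  L-interval (suc zero) _ = 0 , z<s , s≤s z≤n
  L-interval (suc k@(suc _)) _ with L-interval k z<s
  ... | i , Li<k , k≤L with m≤n⇒m<n∨m≡n k≤L
  ...   | inj₁ k<L  = i , <-trans Li<k ≤-refl , k<L
  ...   | inj₂ refl = suc i , ≤-refl , L<L-suc (suc i)

-- Block structure of binary sequences

InBlock : (start len : ℕ → ℕ) → ℕ → ℕ → Set
InBlock start len p i = start i ≤ p × p < start i + len i

-- The strict inequality between an end and the next start leaves a 0 between the intervals, so that
-- no two of them merge into one block.
blockLengthSequence :
  (s : ℕ → Bool) (start len : ℕ → ℕ) →
  (∀ i → 0 < len i) → (∀ i → start i + len i < start (suc i)) →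
  (∀ p i → InBlock start len p i → s p ≡ true) →
  (∀ p → s p ≡ true → ∃[ i ] InBlock start len p i) →
  IsBlockLengthSequence s len
blockLengthSequence s start len 0<len gap block⇒1 1⇒block = record
  { start    = start
  ; ordered  = λ i → ≤-<-trans (m≤m+n _ _) (gap i)
  ; maximal  = λ i → record
    { nonempty = 0<len i
    ; ones     = ones i
    ; endsʳ    = ends i
    ; endsˡ    = begins i
    }
  ; complete = complete
  }
  where
  start-mono : ∀ {i j} → i ≤ j → start i ≤ start j
  start-mono {j = zero}  z≤n = ≤-refl
  start-mono {j = suc j} i≤1+j with m≤n⇒m<n∨m≡n i≤1+j
  ... | inj₁ i<1+j =
    ≤-trans (start-mono (s≤s⁻¹ i<1+j)) (≤-trans (m≤m+n _ _) (<⇒≤ (gap j)))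
  ... | inj₂ refl  = ≤-refl

  end<start : ∀ {i j} → i < j → start i + len i < start j
  end<start i<j = <-≤-trans (gap _) (start-mono i<j)

  end≤end : ∀ {i j} → i ≤ j → start i + len i ≤ start j + len j
  end≤end i≤j with m≤n⇒m<n∨m≡n i≤j
  ... | inj₁ i<j  = ≤-trans (<⇒≤ (end<start i<j)) (m≤m+n _ _)
  ... | inj₂ refl = ≤-refl

  ones : ∀ i k → k < len i → s (start i + k) ≡ true
  ones i k k<len = block⇒1 _ i (m≤m+n _ _ , +-monoʳ-< (start i) k<len)

  ends : ∀ i → s (start i + len i) ≡ false
  ends i = ¬-not λ eq → ∉block (1⇒block _ eq)
    where
    ∉block : ¬ (∃[ j ] InBlock start len (start i + len i) j)
    ∉block (j , lo , hi) with <-≤-connex i j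
    ... | inj₁ i<j = <⇒≱ (end<start i<j) lo
    ... | inj₂ j≤i = <⇒≱ hi (end≤end j≤i)

  begins : ∀ i p → suc p ≡ start i → s p ≡ false
  begins i p 1+p≡start = ¬-not λ eq → ∉block (1⇒block p eq)
    where
    ∉block : ¬ (∃[ j ] InBlock start len p j)
    ∉block (j , lo , hi) with <-≤-connex j i
    ... | inj₁ j<i = <⇒≱ hi (s≤s⁻¹ (subst (start j + len j <_) (sym 1+p≡start) (end<start j<i)))
    ... | inj₂ i≤j = <⇒≱ (≤-reflexive 1+p≡start) (≤-trans (start-mono i≤j) lo)

  open IsMaximalBlock using (nonempty; endsʳ; endsˡ) renaming (ones to ones-of)

  -- Otherwise the left neighbour of `a` would lie in the same interval and carry a 1.
  starts : ∀ {a ℓ i} → IsMaximalBlock s a ℓ → InBlock start len a i → a ≡ start i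
  starts {zero}  b (lo , _) = sym (n≤0⇒n≡0 lo)
  starts {suc p} {i = i} b (lo , hi) with m≤n⇒m<n∨m≡n lo
  ... | inj₂ eq = sym eq
  ... | inj₁ lt = contradiction
    (trans (sym (block⇒1 p i (s≤s⁻¹ lt , <-trans ≤-refl hi))) (endsˡ b p refl)) λ ()

  complete : ∀ a ℓ → IsMaximalBlock s a ℓ → ∃[ i ] (a ≡ start i × ℓ ≡ len i)
  complete a ℓ b
    with 1⇒block a (subst (λ p → s p ≡ true) (+-identityʳ a) (ones-of b 0 (nonempty b)))
  ... | i , inb with starts b inb
  -- A shorter block would end on a 1 of the interval, a longer one would contain the 0 just after
  -- it.
  ... | refl with <-cmp ℓ (len i)
  ...   | tri< ℓ<len _ _ = contradiction (trans (sym (ones i ℓ ℓ<len)) (endsʳ b)) λ ()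
  ...   | tri≈ _ eq _    = i , refl , eq
  ...   | tri> _ _ len<ℓ = contradiction (trans (sym (ones-of b (len i) len<ℓ)) (ends i)) λ ()

-- The blocks of the oc-sequence.

does⇒ : {P : Set} (P? : Dec P) → does P? ≡ true → P
does⇒ (yes p) _ = p

corollary50 : (m : ℕ) .{{_ : NonTrivial m}} (w : ℕ → Fin m) →
    IsMBonacciWord m w → IsBlockLengthSequence (oc w) (blockLengths m)
corollary50 m w isW =
  blockLengthSequence (oc w) start (blockLengths m) 0<len gap block⇒1 1⇒block
  where
  open MBonacci m w isW

  -- oc w has index n for the prefix of length n + 1, so the block of the
  -- prefixes of lengths H (i + 1) + k with L i < k ≤ L (i + 1) starts here.
  start : ℕ → ℕ
  start zero    = 0
  start (suc i) = H (suc i) + L i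

  0<len : ∀ i → 0 < blockLengths m i
  0<len zero    = z<s
  0<len (suc i) = 0<H i

  -- In this form the end of a block and the start of the next differ only in their `H` term.
  start+len : ∀ i → start (suc i) + H i ≡ H (suc i) + L (suc i)
  start+len i = begin
    H (suc i) + L i + H i   ≡⟨ +-assoc (H (suc i)) (L i) (H i) ⟩
    H (suc i) + (L i + H i) ≡⟨ cong (H (suc i) +_) (trans (+-comm (L i) (H i)) (sym (L-suc i))) ⟩
    H (suc i) + L (suc i)   ∎
    where open ≡-Reasoning

  gap : ∀ i → start i + blockLengths m i < start (suc i)
  -- Index 0 is the one-letter prefix and the next block starts at `H 1`, which exceeds `H 0 = 1`.
  gap zero    = subst (1 <_) (sym (+-identityʳ (H 1))) (H<H-suc 0)
  gap (suc i) = subst (_< start (2+ i)) (sym (start+len i)) (+-monoˡ-< (L (suc i)) (H<H-suc (suc i)))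

  block⇒1 : ∀ p i → InBlock start (blockLengths m) p i → oc w p ≡ true
  block⇒1 p i inb = dec-true (closed? _≟_ (prefixOf w (suc p))) (closed i inb)
    where
    closed : ∀ i → InBlock start (blockLengths m) p i → Closed (prefixOf w (suc p))
    closed zero    (_ , p<1) = inj₁ (trans (length-applyUpTo w (suc p)) (cong suc (n<1⇒n≡0 p<1)))
    closed (suc i) (lo , hi) =
      subst (λ n → Closed (prefixOf w n)) H+k≡1+p
        (firstReturn⇒closed w (m<n⇒0<n Li<k) (firstReturn-H i k Li<k k≤L))
      where
      k : ℕ
      -- The border length is what remains of the prefix length after the return time.
      k = suc p ∸ H (suc i)

      H+k≡1+p : H (suc i) + k ≡ suc p
      H+k≡1+p = m+[n∸m]≡n (≤-trans (m≤m+n _ (L i)) (≤-trans lo (n≤1+n p)))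

      Li<k : L i < k
      Li<k = +-cancelˡ-< (H (suc i)) _ _ (subst (start (suc i) <_) (sym H+k≡1+p) (s≤s lo))

      k≤L : k ≤ L (suc i)
      k≤L = +-cancelˡ-≤ (H (suc i)) _ _
        (subst (_≤ H (suc i) + L (suc i)) (sym H+k≡1+p) (subst (p <_) (start+len i) hi))

  1⇒block : ∀ p → oc w p ≡ true → ∃[ i ] InBlock start (blockLengths m) p i
  1⇒block p eq with closed⇒firstReturn w (suc p) (does⇒ (closed? _≟_ (prefixOf w (suc p))) eq)
  ... | inj₁ refl = 0 , z≤n , z<s
  ... | inj₂ (k , r , 0<k , r+k≡1+p , ret) with L-interval k 0<k
  ... | i , Li<k , k≤L = suc i , lo , hi
    where
    open FirstReturn

    ret′ : FirstReturn w k (H (suc i))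
    ret′ = firstReturn-H i k Li<k k≤L

    -- Both `r` and `H (suc i)` are first returns of the same prefix, so minimality identifies them.
    H+k≡1+p : H (suc i) + k ≡ suc p
    H+k≡1+p = trans (cong (_+ k) (≤-antisym (minimal ret′ r (positive ret) (returns ret))
                                            (minimal ret _ (positive ret′) (returns ret′))))
                    r+k≡1+p

    lo : start (suc i) ≤ p
    lo = s≤s⁻¹ (subst (start (suc i) <_) H+k≡1+p (+-monoʳ-< (H (suc i)) Li<k))

    hi : p < start (suc i) + H i
    hi = subst (p <_) (sym (start+len i))
      (subst (_≤ H (suc i) + L (suc i)) H+k≡1+p (+-monoʳ-≤ (H (suc i)) k≤L))
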